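{- For any $\alpha>0$, there exists $C>0$ such that the following holds. Let $G$ be an $n$-vertex graph admitting an edge coloring with $n$ colors such that each color class has size at least two. If there are at least $\alpha n$ color classes each of which contains either a matching of size two or a triangle, then the rainbow girth of $G$ is at most $C\log n$.
   Context: An edge coloring of a graph $G$ with $m$ colors is any map $\lambda:E(G)\to[m]$ (not necessarily proper); for $i\in[m]$ the set $\lambda^{ -1}(i)$ is a color class. A subgraph of $G$ is rainbow if no two of its edges lie in the same color class. The rainbow girth of $G$ is the minimum length of a rainbow cycle in $G$ ($\infty$ if none exists). A matching of size two is a pair of vertex-disjoint edges; a color class contains a triangle if it contains the three edges of some triangle. -}

module Defs where

open import Data.Nat as ℕ using (ℕ; zero; suc; _≤_; _+_)
open import Data.Fin using (Fin; zero; suc; toℕ; lower₁)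
open import Data.Bool using (Bool; true; false)
open import Data.Product using (Σ; ∃; _×_; _,_)
open import Data.Sum using (_⊎_)
open import Data.List using (List; length)
open import Data.List.Relation.Unary.All using (All)
open import Data.List.Relation.Unary.Unique.Propositional using (Unique)
open import Relation.Binary.PropositionalEquality using (_≡_; _≢_)
open import Relation.Nullary using (¬_; yes; no)
open import Function.Definitions using (Injective)

record Graph (n : ℕ) : Set where
  field
    adj     : Fin n → Fin n → Bool
    symm    : ∀ u v → adj u v ≡ adj v u
    irrefl  : ∀ v → adj v v ≡ false

open Graph public

Adj : ∀ {n} → Graph n → Fin n → Fin n → Set
Adj G u v = adj G u v ≡ true

-- An edge colouring with m colours: a colour for every edge {u,v}.
-- It is given as a symmetric function on pairs of vertices; its values on
-- non-edges are irrelevant (every map E(G) → [m] arises this way).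
record EdgeColoring {n : ℕ} (G : Graph n) (m : ℕ) : Set where
  field
    col     : Fin n → Fin n → Fin m
    colSym  : ∀ u v → col u v ≡ col v u

open EdgeColoring public

SameEdge : ∀ {n} → Fin n → Fin n → Fin n → Fin n → Set
SameEdge u v x y = (u ≡ x × v ≡ y) ⊎ (u ≡ y × v ≡ x)

InClass : ∀ {n m} {G : Graph n} → EdgeColoring G m → Fin m → Fin n → Fin n → Set
InClass {G = G} λc i u v = Adj G u v × col λc u v ≡ i

ClassSizeAtLeastTwo : ∀ {n m} {G : Graph n} → EdgeColoring G m → Fin m → Set
ClassSizeAtLeastTwo λc i =
  Σ _ λ u → Σ _ λ v → Σ _ λ x → Σ _ λ y →
    InClass λc i u v × InClass λc i x y × ¬ SameEdge u v x y

ClassHasMatching2 : ∀ {n m} {G : Graph n} → EdgeColoring G m → Fin m → Set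
ClassHasMatching2 λc i =
  Σ _ λ a → Σ _ λ b → Σ _ λ c → Σ _ λ d →
    InClass λc i a b × InClass λc i c d ×
    a ≢ c × a ≢ d × b ≢ c × b ≢ d

ClassHasTriangle : ∀ {n m} {G : Graph n} → EdgeColoring G m → Fin m → Set
ClassHasTriangle λc i =
  Σ _ λ a → Σ _ λ b → Σ _ λ c →
    InClass λc i a b × InClass λc i b c × InClass λc i a c

next : ∀ {k} → Fin (suc k) → Fin (suc k)
next {k} i with k ℕ.≟ toℕ i
... | yes _ = zero
... | no ne = suc (lower₁ i ne)

record RainbowCycle {n m : ℕ} {G : Graph n} (λc : EdgeColoring G m) (k : ℕ) : Set where
  field
    len≥3     : 3 ≤ suc k
    vert      : Fin (suc k) → Fin n
    vertInj   : Injective _≡_ _≡_ vert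
    adjacent  : (i : Fin (suc k)) → Adj G (vert i) (vert (next i))
    rainbow   : Injective _≡_ _≡_ (λ i → col λc (vert i) (vert (next i)))

RainbowGirthAtMost : ∀ {n m} {G : Graph n} → EdgeColoring G m → ℕ → Set
RainbowGirthAtMost λc L = Σ ℕ λ k → suc k ≤ L × RainbowCycle λc k

{-# OPTIONS --safe #-}

-- Every color class contains either two edges at a common centre, a matching of size
-- two, or a triangle. Delete a set D of vertices that contains no centre of a star class
-- and never two vertices that jointly meet all the edges singled out in one class: then
-- every class keeps an edge. At least αn vertices are not centres, and the forbidden
-- pairs number at most 4n, so a greedy independent set gives such a D of size at least
-- n/K with K depending only on α. One surviving edge per color now yields n edges on at
-- most (1 − 1/K)n vertices, and any cycle formed by them is rainbow.
--
-- A graph with more than (1 + 1/K) edges per vertex has a cycle of length O(K log n):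
-- grow a ball in breadth-first order. An edge both of whose ends are already absorbed
-- closes a short cycle; otherwise each boundary edge adds a vertex. If fewer than |B|/K
-- edges leave the ball B, deleting B removes at most (1 + 1/K)|B| edges, and the density
-- persists. Otherwise the ball grows by a factor 1 + 1/K, which can happen only O(K log n)
-- times.

module Submission where

open import Defs
open import Data.Nat hiding (_/_)
open import Data.Nat.Properties
open import Data.Nat.Induction using (<-rec)
open import Data.Nat.Logarithm using (⌈log₂_⌉; ⌈log₂⌈n/2⌉⌉≡⌈log₂n⌉∸1)
open import Data.Nat.Tactic.RingSolver using (solve-∀)
open import Data.Integer using (+_)
import Data.Integer as ℤ
import Data.Integer.Properties as ℤ
open import Data.Rational using (ℚ; mkℚ; Positive; _/_; toℚᵘ) renaming (_*_ to _*ℚ_; _≤_ to _≤ℚ_)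
import Data.Rational.Properties as ℚ
import Data.Rational.Unnormalised as ℚᵘ
import Data.Rational.Unnormalised.Properties as ℚᵘ
open import Data.Fin using (Fin; zero; suc; toℕ; lower₁)
import Data.Fin as Fin
import Data.Fin.Properties as Fin
open import Data.Product using (Σ; _×_; _,_; proj₁; proj₂)
open import Data.Sum using (_⊎_; inj₁; inj₂; [_,_]′)
open import Data.List using (List; []; _∷_; _++_; length; filter; map; concatMap; allFin)
open import Data.List.Properties using (length-++; length-map; length-tabulate)
import Data.List.Membership.DecPropositional as ListDec
open import Data.List.Membership.Propositional using (_∈_; _∉_; lose)
open import Data.List.Membership.Propositional.Properties
  using (∈-∃++; ∈-++⁺ˡ; ∈-++⁺ʳ; ∈-++⁻; ∈-filter⁺; ∈-filter⁻; ∈-map⁺; ∈-concatMap⁺; ∈-allFin)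
open import Data.List.Relation.Binary.Subset.Propositional using (_⊆_)
open import Data.List.Relation.Unary.All as All using (All; []; _∷_)
open import Data.List.Relation.Unary.All.Properties using (¬Any⇒All¬; All¬⇒¬Any)
open import Data.List.Relation.Unary.AllPairs using ([]; _∷_)
open import Data.List.Relation.Unary.Any using (here; there)
open import Data.List.Relation.Unary.Unique.Propositional using (Unique)
open import Data.List.Relation.Unary.Unique.Propositional.Properties using (++⁺; filter⁺; allFin⁺)
open import Data.Vec using (Vec; []; _∷_; lookup)
import Data.Vec.Membership.DecPropositional as VecDec
import Data.Vec.Membership.Propositional as VecMem
import Data.Vec.Relation.Unary.All as VecAll
import Data.Vec.Relation.Unary.AllPairs as VecAllPairs
import Data.Vec.Relation.Unary.Any as VecAny
import Data.Vec.Relation.Unary.Unique.Propositional as VecUnique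
import Data.Vec.Relation.Unary.Unique.Propositional.Properties as VecUnique
open import Function using (_∘_)
open import Relation.Binary.Definitions using (DecidableEquality)
open import Relation.Binary.PropositionalEquality
open import Relation.Nullary using (¬_; Dec; yes; no; ¬?; _⊎-dec_; contradiction)
open import Relation.Unary using (Decidable)

-- Logarithms and the growth of powers of 1 + 1/k.

n≤2^⌈log₂n⌉ : ∀ n → n ≤ 2 ^ ⌈log₂ n ⌉
n≤2^⌈log₂n⌉ = <-rec _ step
  where
  step : ∀ n → (∀ {m} → m < n → m ≤ 2 ^ ⌈log₂ m ⌉) → n ≤ 2 ^ ⌈log₂ n ⌉
  step 0 _ = z≤n
  step 1 _ = s≤s z≤n
  step (suc (suc n)) rec = begin
    suc (suc n)                            ≡⟨ sym (⌊n/2⌋+⌈n/2⌉≡n (suc (suc n))) ⟩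
    ⌊ 2 + n /2⌋ + ⌈ 2 + n /2⌉              ≤⟨ +-monoˡ-≤ _ (⌊n/2⌋≤⌈n/2⌉ (2 + n)) ⟩
    ⌈ 2 + n /2⌉ + ⌈ 2 + n /2⌉              ≡⟨ cong (λ k → ⌈ 2 + n /2⌉ + k) (sym (+-identityʳ _)) ⟩
    2 * ⌈ 2 + n /2⌉                        ≤⟨ *-monoʳ-≤ 2 (rec (⌈n/2⌉<n n)) ⟩
    2 * 2 ^ ⌈log₂ ⌈ 2 + n /2⌉ ⌉            ≡⟨ cong (λ l → 2 * 2 ^ l) (⌈log₂⌈n/2⌉⌉≡⌈log₂n⌉∸1 (2 + n)) ⟩
    2 ^ ⌈log₂ 2 + n ⌉                      ∎
    where
    open ≤-Reasoning

-- Bernoulli's inequality (1 + 1/k)^j ≥ 1 + j/k with denominators cleared. The induction step gives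
-- away the term `k ^ j * j`.
bernoulli : ∀ k j → k ^ j * (k + j) ≤ k * suc k ^ j
bernoulli k zero    = ≤-reflexive (base k)
  where
  base : ∀ k → 1 * (k + 0) ≡ k * 1
  base = solve-∀
bernoulli k (suc j) = begin
  k ^ suc j * (k + suc j)      ≤⟨ m≤m+n _ (k ^ j * j) ⟩
  k ^ suc j * (k + suc j) + k ^ j * j ≡⟨ expand k j (k ^ j) ⟩
  suc k * (k ^ j * (k + j))    ≤⟨ *-monoʳ-≤ (suc k) (bernoulli k j) ⟩
  suc k * (k * suc k ^ j)      ≡⟨ swap k (suc k ^ j) ⟩
  k * suc k ^ suc j            ∎
  where
  open ≤-Reasoning
  expand : ∀ k j p → k * p * (k + suc j) + p * j ≡ suc k * (p * (k + j))
  expand = solve-∀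
  swap : ∀ k p → suc k * (k * p) ≡ k * (suc k * p)
  swap = solve-∀

-- Bernoulli at exponent `k`: a ball growing by the factor 1 + 1/k doubles in `k` steps.
2*k^k≤[1+k]^k : ∀ k .{{_ : NonZero k}} → 2 * k ^ k ≤ suc k ^ k
2*k^k≤[1+k]^k k = *-cancelˡ-≤ k (begin
  k * (2 * k ^ k)   ≡⟨ shuffle k (k ^ k) ⟩
  k ^ k * (k + k)   ≤⟨ bernoulli k k ⟩
  k * suc k ^ k     ∎)
  where
  open ≤-Reasoning
  shuffle : ∀ k p → k * (2 * p) ≡ p * (k + k)
  shuffle = solve-∀

^-distribʳ-* : ∀ l m n → (m * n) ^ l ≡ m ^ l * n ^ l
^-distribʳ-* zero    m n = refl
^-distribʳ-* (suc l) m n = trans (cong (m * n *_) (^-distribʳ-* l m n)) ([m*n]*[o*p]≡[m*o]*[n*p] m n (m ^ l) (n ^ l))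

2^l*k^kl≤[1+k]^kl : ∀ k l .{{_ : NonZero k}} → 2 ^ l * k ^ (k * l) ≤ suc k ^ (k * l)
2^l*k^kl≤[1+k]^kl k l = begin
  2 ^ l * k ^ (k * l)    ≡⟨ cong (2 ^ l *_) (sym (^-*-assoc k k l)) ⟩
  2 ^ l * (k ^ k) ^ l    ≡⟨ sym (^-distribʳ-* l 2 (k ^ k)) ⟩
  (2 * k ^ k) ^ l        ≤⟨ ^-monoˡ-≤ l (2*k^k≤[1+k]^k k) ⟩
  (suc k ^ k) ^ l        ≡⟨ ^-*-assoc (suc k) k l ⟩
  suc k ^ (k * l)        ∎
  where open ≤-Reasoning

-- Counting in duplicate-free lists.

module _ {A : Set} where

  x∷xs-unique⇒x∉xs : ∀ {x : A} {xs} → Unique (x ∷ xs) → x ∉ xs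
  x∷xs-unique⇒x∉xs (x≢xs ∷ _) = All¬⇒¬Any x≢xs

  ∷-unique : ∀ {x : A} {xs} → x ∉ xs → Unique xs → Unique (x ∷ xs)
  ∷-unique x∉xs uxs = ¬Any⇒All¬ _ x∉xs ∷ uxs

  unique-⊆⇒length≤ : ∀ {xs ys : List A} → Unique xs → xs ⊆ ys → length xs ≤ length ys
  unique-⊆⇒length≤ {[]}     _ _ = z≤n
  unique-⊆⇒length≤ {x ∷ xs} u@(_ ∷ uxs) xs⊆ys
    with as , bs , refl ← ∈-∃++ (xs⊆ys (here refl)) = begin
      suc (length xs)               ≤⟨ s≤s (unique-⊆⇒length≤ uxs drop-x) ⟩
      suc (length (as ++ bs))       ≡⟨ cong suc (length-++ as) ⟩
      suc (length as + length bs)   ≡⟨ sym (+-suc _ _) ⟩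
      length as + suc (length bs)   ≡⟨ sym (length-++ as) ⟩
      length (as ++ x ∷ bs)         ∎
    where
    open ≤-Reasoning
    drop-x : xs ⊆ as ++ bs
    drop-x z∈xs with ∈-++⁻ as (xs⊆ys (there z∈xs))
    ... | inj₁ z∈as         = ∈-++⁺ˡ z∈as
    ... | inj₂ (here refl)  = contradiction z∈xs (x∷xs-unique⇒x∉xs u)
    ... | inj₂ (there z∈bs) = ∈-++⁺ʳ as z∈bs

  length-filter+filter-¬ : ∀ {P : A → Set} (P? : Decidable P) xs →
    length (filter P? xs) + length (filter (¬? ∘ P?) xs) ≡ length xs
  length-filter+filter-¬ P? []       = refl
  length-filter+filter-¬ P? (x ∷ xs) with P? x
  ... | yes _ = cong suc (length-filter+filter-¬ P? xs)
  ... | no  _ = trans (+-suc _ _) (cong suc (length-filter+filter-¬ P? xs))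

  length-concatMap-≤ : ∀ {B : Set} (f : A → List B) k → (∀ x → length (f x) ≤ k) →
    ∀ xs → length (concatMap f xs) ≤ length xs * k
  length-concatMap-≤ f k bound []       = z≤n
  length-concatMap-≤ f k bound (x ∷ xs) = begin
    length (f x ++ concatMap f xs)          ≡⟨ length-++ (f x) ⟩
    length (f x) + length (concatMap f xs)  ≤⟨ +-mono-≤ (bound x) (length-concatMap-≤ f k bound xs) ⟩
    k + length xs * k                       ∎
    where open ≤-Reasoning

-- Greedy independent sets.

-- Concluding `a ≡ b` instead of a contradiction makes degenerate pairs harmless; users supply the
-- distinctness themselves.
Independent : {A : Set} → List (A × A) → List A → Set
Independent H D = ∀ {a b} → (a , b) ∈ H → a ∈ D → b ∈ D → a ≡ b

module _ {A : Set} (_≟_ : DecidableEquality A) where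

  open ListDec _≟_ using (_∉?_)

  infixl 6 _∖_
  _∖_ : List A → List A → List A
  xs ∖ ys = filter (_∉? ys) xs

  length-∖-≥ : ∀ {xs} ys → Unique xs → length xs ≤ length (xs ∖ ys) + length ys
  length-∖-≥ {xs} ys uxs = begin
    length xs                       ≤⟨ unique-⊆⇒length≤ uxs split ⟩
    length (xs ∖ ys ++ ys)          ≡⟨ length-++ (xs ∖ ys) ⟩
    length (xs ∖ ys) + length ys    ∎
    where
    open ≤-Reasoning
    split : xs ⊆ xs ∖ ys ++ ys
    split {x} x∈xs with x ∉? ys
    ... | yes x∉ys = ∈-++⁺ˡ (∈-filter⁺ (_∉? ys) x∈xs x∉ys)
    ... | no ¬x∉ys with ListDec._∈?_ _≟_ x ys
    ...   | yes x∈ys = ∈-++⁺ʳ (xs ∖ ys) x∈ys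
    ...   | no  x∉ys = contradiction x∉ys ¬x∉ys

  length-∖-≤ : ∀ {xs ys} → Unique xs → Unique ys → ys ⊆ xs →
    length (xs ∖ ys) + length ys ≤ length xs
  length-∖-≤ {xs} {ys} uxs uys ys⊆xs = begin
    length (xs ∖ ys) + length ys  ≡⟨ sym (length-++ (xs ∖ ys)) ⟩
    length (xs ∖ ys ++ ys)        ≤⟨ unique-⊆⇒length≤ (++⁺ (filter⁺ _ uxs) uys disj) join ⟩
    length xs                     ∎
    where
    open ≤-Reasoning
    disj : ∀ {x} → ¬ (x ∈ xs ∖ ys × x ∈ ys)
    disj (x∈∖ , x∈ys) = proj₂ (∈-filter⁻ (_∉? ys) {xs = xs} x∈∖) x∈ys
    join : xs ∖ ys ++ ys ⊆ xs
    join = [ proj₁ ∘ ∈-filter⁻ (_∉? ys) , ys⊆xs ]′ ∘ ∈-++⁻ (xs ∖ ys)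

  private
    Incident : A → A × A → Set
    Incident z (a , b) = a ≡ z ⊎ b ≡ z

    incident? : ∀ z → Decidable (Incident z)
    incident? z (a , b) = (a ≟ z) ⊎-dec (b ≟ z)

    other : A → A × A → A
    other z (a , b) with a ≟ z
    ... | yes _ = b
    ... | no  _ = a

  -- The field `large` is the bound |set| ≥ (t|Z| - |H|) / (t(t + 1)) without subtraction or
  -- division.
  record IndependentIn (t : ℕ) (H : List (A × A)) (Z : List A) : Set where
    field
      set         : List A
      set⊆Z       : set ⊆ Z
      unique      : Unique set
      independent : Independent H set
      large       : t * length Z ≤ length H + t * suc t * length set

  -- Greedy: a vertex on at least t pairs is discarded, paying with its pairs;
  -- any other vertex is taken and its fewer than t neighbours are discarded.
  independentIn : ∀ t {Z} H → Unique Z → IndependentIn t H Z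
  independentIn t {Z} H uZ = go (length Z) ≤-refl H uZ
    where
    -- Discarding neighbours leaves a list that is not structurally smaller, so the recursion runs
    -- on a bound for its length.
    go : ∀ fuel {Z} → length Z ≤ fuel → ∀ H → Unique Z → IndependentIn t H Z
    go _ {[]} _ H _ = record
      { set = [] ; set⊆Z = λ () ; unique = [] ; independent = λ _ ()
      ; large = ≤-trans (≤-reflexive (*-zeroʳ t)) z≤n }
    go (suc fuel) {z ∷ Z} (s≤s Z≤fuel) H u@(_ ∷ uZ) = choose (t ≤? h)
      where
      open ≤-Reasoning
      at off : List (A × A)
      at  = filter (incident? z) H
      off = filter (¬? ∘ incident? z) H
      h   = length at

      at+off : h + length off ≡ length H
      at+off = length-filter+filter-¬ (incident? z) H

      choose : Dec (t ≤ h) → IndependentIn t H (z ∷ Z)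
      choose (yes t≤h) = record
        { set = set ; set⊆Z = there ∘ set⊆Z ; unique = unique
        ; independent = indep ; large = large′ }
        where
        open IndependentIn (go fuel Z≤fuel off uZ)
        z∉set : z ∉ set
        z∉set = x∷xs-unique⇒x∉xs u ∘ set⊆Z
        indep : Independent H set
        indep ab∈H a∈ b∈ = independent (∈-filter⁺ (¬? ∘ incident? z) ab∈H
          λ { (inj₁ refl) → z∉set a∈ ; (inj₂ refl) → z∉set b∈ }) a∈ b∈
        large′ : t * suc (length Z) ≤ length H + t * suc t * length set
        large′ = begin
          t * suc (length Z)                            ≡⟨ *-suc t _ ⟩
          t + t * length Z                              ≤⟨ +-mono-≤ t≤h large ⟩
          h + (length off + t * suc t * length set)     ≡⟨ sym (+-assoc h _ _) ⟩
          h + length off + t * suc t * length set       ≡⟨ cong (_+ t * suc t * length set) at+off ⟩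
          length H + t * suc t * length set             ∎
      choose (no t≰h) = record
        { set = z ∷ set ; set⊆Z = λ { (here p) → here p ; (there x∈) → there (set⊆Z′ x∈) }
        ; unique = ∷-unique (x∷xs-unique⇒x∉xs u ∘ set⊆Z′) unique
        ; independent = indep ; large = large′ }
        where
        nbrs Z′ : List A
        nbrs = map (other z) at
        Z′   = Z ∖ nbrs
        length-Z′ : length Z ≤ length Z′ + h
        length-Z′ = subst (λ l → length Z ≤ length Z′ + l) (length-map (other z) at) (length-∖-≥ nbrs uZ)
        open IndependentIn (go fuel {Z′} (≤-trans (m+n≤o⇒m≤o _ (≤-reflexive (length-filter+filter-¬ (_∉? nbrs) Z))) Z≤fuel) off (filter⁺ (_∉? nbrs) uZ))
        set⊆Z′ : set ⊆ Z
        set⊆Z′ = proj₁ ∘ ∈-filter⁻ (_∉? nbrs) ∘ set⊆Z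
        set∉nbrs : ∀ {x} → x ∈ set → x ∉ nbrs
        set∉nbrs = proj₂ ∘ ∈-filter⁻ (_∉? nbrs) {xs = Z} ∘ set⊆Z
        z∉set : z ∉ set
        z∉set = x∷xs-unique⇒x∉xs u ∘ set⊆Z′
        other∈nbrs : ∀ {p} → p ∈ H → Incident z p → other z p ∈ nbrs
        other∈nbrs p∈H i = ∈-map⁺ (other z) (∈-filter⁺ (incident? z) p∈H i)
        other-fst : ∀ b → other z (z , b) ≡ b
        other-fst b with z ≟ z
        ... | yes _  = refl
        ... | no z≢z = contradiction refl z≢z
        other-snd : ∀ {a} → a ≢ z → other z (a , z) ≡ a
        other-snd {a} a≢z with a ≟ z
        ... | yes a≡z = contradiction a≡z a≢z
        ... | no _    = refl
        indep : Independent H (z ∷ set)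
        indep ab∈H (here refl) (here refl) = refl
        indep {b = b} ab∈H (here refl) (there b∈) =
          contradiction (subst (_∈ nbrs) (other-fst b) (other∈nbrs ab∈H (inj₁ refl))) (set∉nbrs b∈)
        indep ab∈H (there a∈) (here refl) =
          contradiction (subst (_∈ nbrs) (other-snd λ { refl → z∉set a∈ }) (other∈nbrs ab∈H (inj₂ refl))) (set∉nbrs a∈)
        indep ab∈H (there a∈) (there b∈) = independent (∈-filter⁺ (¬? ∘ incident? z) ab∈H
          λ { (inj₁ refl) → z∉set a∈ ; (inj₂ refl) → z∉set b∈ }) a∈ b∈
        -- Taking `z` costs `t` for `z` itself and at most `t * t` for its discarded neighbours;
        -- together this is the coefficient `t * suc t`.
        expand : ∀ t o s → t + (o + t * suc t * s + t * t) ≡ o + t * suc t * suc s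
        expand = solve-∀
        large′ : t * suc (length Z) ≤ length H + t * suc t * suc (length set)
        large′ = begin
          t * suc (length Z)                                        ≡⟨ *-suc t _ ⟩
          t + t * length Z                                          ≤⟨ +-monoʳ-≤ t (*-monoʳ-≤ t length-Z′) ⟩
          t + t * (length Z′ + h)                                   ≡⟨ cong (λ k → t + k) (*-distribˡ-+ t (length Z′) h) ⟩
          t + (t * length Z′ + t * h)                               ≤⟨ +-monoʳ-≤ t (+-mono-≤ large (*-monoʳ-≤ t (<⇒≤ (≰⇒> t≰h)))) ⟩
          t + (length off + t * suc t * length set + t * t)         ≡⟨ expand t (length off) (length set) ⟩
          length off + t * suc t * suc (length set)                 ≤⟨ +-monoˡ-≤ _ (m+n≤o⇒n≤o h (≤-reflexive at+off)) ⟩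
          length H + t * suc t * suc (length set)                   ∎

-- Elementary facts on vertices and color classes.

unique-allFin-length : ∀ {n} {xs : List (Fin n)} → Unique xs → length xs ≤ n
unique-allFin-length {n} {xs} uxs =
  subst (length xs ≤_) (length-tabulate {n = n} _) (unique-⊆⇒length≤ uxs λ _ → ∈-allFin _)

∉⇒All≢ : ∀ {A : Set} {x : A} {k} {xs : Vec A k} → x VecMem.∉ xs → VecAll.All (x ≢_) xs
∉⇒All≢ {xs = []}     _   = VecAll.[]
∉⇒All≢ {xs = y ∷ xs} x∉ = VecAll._∷_ (x∉ ∘ VecAny.here) (∉⇒All≢ (x∉ ∘ VecAny.there))

module _ {n m : ℕ} {G : Graph n} (λc : EdgeColoring G m) where

  inClass-sym : ∀ {i u v} → InClass λc i u v → InClass λc i v u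
  inClass-sym {i} {u} {v} (adj , col≡i) = trans (symm G v u) adj , trans (colSym λc v u) col≡i

  inClass⇒≢ : ∀ {i u v} → InClass λc i u v → u ≢ v
  inClass⇒≢ {u = u} (adj , _) refl with () ← trans (sym adj) (irrefl G u)

-- Walks, paths and rainbow cycles with one chosen edge per color.

module Transversal {n m : ℕ} {G : Graph n} (λc : EdgeColoring G m)
  (src tgt : Fin m → Fin n) (edge : ∀ i → InClass λc i (src i) (tgt i)) where

  private
    V C : Set
    V = Fin n
    C = Fin m

  -- With one chosen edge per color, a color serves as the name of its edge, and distinct chosen
  -- edges automatically differ in color.
  Joins : C → V → V → Set
  Joins i = SameEdge (src i) (tgt i)

  joins-sym : ∀ {i x y} → Joins i x y → Joins i y x
  joins-sym (inj₁ p) = inj₂ p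
  joins-sym (inj₂ p) = inj₁ p

  joins⇒inClass : ∀ {i x y} → Joins i x y → InClass λc i x y
  joins⇒inClass {i} (inj₁ (refl , refl)) = edge i
  joins⇒inClass {i} (inj₂ (refl , refl)) = inClass-sym λc (edge i)

  -- ℓ only bounds the number of steps from above.
  data Walk (F : List C) : V → V → ℕ → Set where
    done : ∀ {x ℓ} → Walk F x x ℓ
    move : ∀ {i x y z ℓ} → Joins i x y → i ∉ F → Walk F y z ℓ → Walk F x z (suc ℓ)

  -- `F` lists forbidden colors. Freshness is imposed on vertices only; distinctness of the colors
  -- follows in `path-colours-unique`. The vectors become the vertices and colors of the cycle.
  data Path (F : List C) : ∀ {k} → V → V → Vec V (suc k) → Vec C k → Set where
    done : ∀ {x} → Path F x x (x ∷ []) []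
    move : ∀ {i x y z k} {vs : Vec V (suc k)} {cs} → Joins i x y → i ∉ F → x VecMem.∉ vs →
           Path F y z vs cs → Path F x z (x ∷ vs) (i ∷ cs)

  walk-suc : ∀ {F x y ℓ} → Walk F x y ℓ → Walk F x y (suc ℓ)
  walk-suc done         = done
  walk-suc (move j f w) = move j f (walk-suc w)

  walk-weaken : ∀ {F F′ x y ℓ} → F′ ⊆ F → Walk F x y ℓ → Walk F′ x y ℓ
  walk-weaken F′⊆F done         = done
  walk-weaken F′⊆F (move j f w) = move j (f ∘ F′⊆F) (walk-weaken F′⊆F w)

  record PathWithin (F : List C) (x z : V) (L : ℕ) : Set where
    constructor within
    field
      {len} : ℕ
      {vs}  : Vec V (suc len)
      {cs}  : Vec C len
      len≤L : len ≤ L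
      path  : Path F x z vs cs

  suffixFrom : ∀ {F x y z k} {vs : Vec V (suc k)} {cs} → Path F y z vs cs → x VecMem.∈ vs →
    PathWithin F x z k
  suffixFrom done             (VecAny.here refl) = within z≤n done
  suffixFrom p@(move _ _ _ _) (VecAny.here refl) = within ≤-refl p
  suffixFrom (move _ _ _ p)   (VecAny.there x∈) with within len≤ q ← suffixFrom p x∈ =
    within (m≤n⇒m≤1+n len≤) q

  -- Loop erasure: a revisited vertex cuts the path back to its suffix from there.
  prepend : ∀ {F i x y z L} → Joins i x y → i ∉ F → PathWithin F y z L → PathWithin F x z (suc L)
  prepend {x = x} j f (within {vs = vs} len≤ p) with VecDec._∈?_ Fin._≟_ x vs
  ... | no  x∉ = within (s≤s len≤) (move j f x∉ p)
  ... | yes x∈ with within len≤′ q ← suffixFrom p x∈ =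
    within (m≤n⇒m≤1+n (≤-trans len≤′ len≤)) q

  pathWithin-≤ : ∀ {F x z L L′} → L ≤ L′ → PathWithin F x z L → PathWithin F x z L′
  pathWithin-≤ L≤L′ (within len≤ p) = within (≤-trans len≤ L≤L′) p

  follow : ∀ {F x y z ℓ L} → Walk F x y ℓ → PathWithin F y z L → PathWithin F x z (ℓ + L)
  follow {ℓ = ℓ} done p = pathWithin-≤ (m≤n+m _ ℓ) p
  follow (move j f w) p = prepend j f (follow w p)

  -- Reversal with an accumulator: walk and path start at the same vertex, and each move of the
  -- walk, turned round, is prepended to the path.
  retrace : ∀ {F x y z ℓ L} → Walk F y x ℓ → PathWithin F y z L → PathWithin F x z (ℓ + L)
  retrace {ℓ = ℓ} done p = pathWithin-≤ (m≤n+m _ ℓ) p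
  retrace {ℓ = suc ℓ} {L} (move j f w) p =
    pathWithin-≤ (≤-reflexive (+-suc ℓ L)) (retrace w (prepend (joins-sym j) f p))

  join : ∀ {F x y r d} → Walk F x r d → Walk F y r d → PathWithin F x y (d + d)
  join {d = d} wx wy = pathWithin-≤ (≤-reflexive (cong (λ k → d + k) (+-identityʳ d)))
    (follow wx (retrace wy (within z≤n done)))

  path-start : ∀ {F x z k} {vs : Vec V (suc k)} {cs} → Path F x z vs cs → lookup vs zero ≡ x
  path-start done           = refl
  path-start (move _ _ _ _) = refl

  path-end : ∀ {F x z k} {vs : Vec V (suc k)} {cs} → Path F x z vs cs →
    ∀ i → k ≡ toℕ i → lookup vs i ≡ z
  path-end done           zero    _ = refl
  path-end (move _ _ _ p) (suc i) e = path-end p i (suc-injective e)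

  path-joins : ∀ {F x z k} {vs : Vec V (suc k)} {cs} → Path F x z vs cs → ∀ i (k≢i : k ≢ toℕ i) →
    Joins (lookup cs (lower₁ i k≢i)) (lookup vs i) (lookup vs (suc (lower₁ i k≢i)))
  path-joins done zero k≢i = contradiction refl k≢i
  path-joins {vs = x ∷ vs} (move {i = c} j _ _ p) zero k≢i =
    subst (Joins c x) (sym (path-start p)) j
  path-joins (move _ _ _ p) (suc i) k≢i = path-joins p i (k≢i ∘ cong suc)

  path-vertices-unique : ∀ {F x z k} {vs : Vec V (suc k)} {cs} → Path F x z vs cs → VecUnique.Unique vs
  path-vertices-unique done            = VecAllPairs._∷_ (VecAll.[]) VecAllPairs.[]
  path-vertices-unique (move _ _ x∉ p) = VecAllPairs._∷_ (∉⇒All≢ x∉) (path-vertices-unique p)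

  path-endpoints : ∀ {F x z k} {vs : Vec V (suc k)} {cs} → Path F x z vs cs → ∀ {i} → i VecMem.∈ cs →
    src i VecMem.∈ vs × tgt i VecMem.∈ vs
  path-endpoints (move {vs = _ ∷ _} j _ _ p) (VecAny.here refl)
    with refl ← path-start p with j
  ... | inj₁ (refl , refl) = VecAny.here refl , VecAny.there (VecAny.here refl)
  ... | inj₂ (refl , refl) = VecAny.there (VecAny.here refl) , VecAny.here refl
  path-endpoints (move _ _ _ p) (VecAny.there i∈)
    with s , t ← path-endpoints p i∈ = VecAny.there s , VecAny.there t

  -- If the first color occurred again, its edge would too, and `x`, an end of that edge, would lie
  -- among the later vertices.
  path-colours-unique : ∀ {F x z k} {vs : Vec V (suc k)} {cs} → Path F x z vs cs → VecUnique.Unique cs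
  path-colours-unique done = VecAllPairs.[]
  path-colours-unique (move j _ x∉ p) =
    VecAllPairs._∷_ (∉⇒All≢ (x∉ ∘ revisits j)) (path-colours-unique p)
    where
    revisits : ∀ {i x y} → Joins i x y → i VecMem.∈ _ → x VecMem.∈ _
    revisits (inj₁ (refl , _)) i∈ = proj₁ (path-endpoints p i∈)
    revisits (inj₂ (_ , refl)) i∈ = proj₂ (path-endpoints p i∈)

  path-colours-∉ : ∀ {F x z k} {vs : Vec V (suc k)} {cs} → Path F x z vs cs → ∀ i → lookup cs i ∉ F
  path-colours-∉ (move _ f _ _) zero    = f
  path-colours-∉ (move _ _ _ p) (suc i) = path-colours-∉ p i

  -- Splits cases exactly as `next` does: the step from the last vertex back to the first carries
  -- the closing color `j`.
  colourAt : ∀ {k} → Vec C k → C → Fin (suc k) → C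
  colourAt {k} cs j i with k ≟ toℕ i
  ... | yes _  = j
  ... | no k≢i = lookup cs (lower₁ i k≢i)

  colourAt-injective : ∀ {k} {cs : Vec C k} {j} → VecUnique.Unique cs → (∀ i → lookup cs i ≢ j) →
    ∀ {a b} → colourAt cs j a ≡ colourAt cs j b → a ≡ b
  colourAt-injective {k} ucs j∉cs {a} {b} eq with k ≟ toℕ a | k ≟ toℕ b
  ... | yes k≡a | yes k≡b = Fin.toℕ-injective (trans (sym k≡a) k≡b)
  ... | yes _   | no  _   = contradiction (sym eq) (j∉cs _)
  ... | no _    | yes _   = contradiction eq (j∉cs _)
  ... | no k≢a  | no k≢b  = Fin.lower₁-injective (VecUnique.lookup-injective ucs _ _ eq)

  closed-joins : ∀ {F x z k} {vs : Vec V (suc k)} {cs j} → Path F x z vs cs → Joins j z x → ∀ i →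
    Joins (colourAt cs j i) (lookup vs i) (lookup vs (next i))
  closed-joins {k = k} {j = j} p jzx i with k ≟ toℕ i
  ... | yes k≡i = subst₂ (Joins j) (sym (path-end p i k≡i)) (sym (path-start p)) jzx
  ... | no  k≢i = path-joins p i k≢i

  -- The path avoids `F` while `j` lies in `F`, which separates the closing color from all others.
  rainbowCycle : ∀ {F x z k} {vs : Vec V (suc k)} {cs j} → 2 ≤ k → Path F x z vs cs → Joins j z x → j ∈ F →
    RainbowCycle λc k
  rainbowCycle {vs = vs} {cs} {j} 2≤k p jzx j∈F = record
    { len≥3    = s≤s 2≤k
    ; vert     = lookup vs
    ; vertInj  = λ {a} {b} → VecUnique.lookup-injective (path-vertices-unique p) a b
    ; adjacent = proj₁ ∘ inClass
    ; rainbow  = λ {a} {b} eq → colourAt-injective (path-colours-unique p) colours≢j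
                   (trans (sym (proj₂ (inClass a))) (trans eq (proj₂ (inClass b))))
    }
    where
    inClass : ∀ i → InClass λc (colourAt cs j i) (lookup vs i) (lookup vs (next i))
    inClass i = joins⇒inClass (closed-joins p jzx i)
    colours≢j : ∀ i → lookup cs i ≢ j
    colours≢j i eq = path-colours-∉ p i (subst (_∈ _) (sym eq) j∈F)

  closeCycle : ∀ {F x y j L} → PathWithin F x y L → Joins j y x → j ∈ F → RainbowGirthAtMost λc (suc L)
  closeCycle (within {0} _ done) j j∈F = contradiction refl (inClass⇒≢ λc (joins⇒inClass j))
  -- Two chosen edges on the same pair of vertices have the same color, so a path of one edge would
  -- use the forbidden `j`.
  closeCycle (within {1} _ (move i i∉F _ done)) j j∈F = contradiction (subst (_∈ _) j≡i j∈F) i∉F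
    where j≡i = trans (sym (proj₂ (joins⇒inClass j))) (proj₂ (joins⇒inClass (joins-sym i)))
  closeCycle (within {suc (suc k)} len≤ p) j j∈F =
    suc (suc k) , s≤s len≤ , rainbowCycle (s≤s (s≤s z≤n)) p j j∈F

  -- Growing balls and carving off sparse pieces.

  open ListDec (Fin._≟_ {n}) using (_∈?_; _∉?_)

  Touches : List V → C → Set
  Touches B i = src i ∈ B ⊎ tgt i ∈ B

  touches? : ∀ B → Decidable (Touches B)
  touches? B i = (src i ∈? B) ⊎-dec (tgt i ∈? B)

  Within : List V → List C → Set
  Within Vs E = ∀ {i} → i ∈ E → src i ∈ Vs × tgt i ∈ Vs

  -- `F` holds the edges not yet absorbed, so the walks to the root `r` use absorbed edges only and
  -- any edge of `F` may close a cycle.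
  Ball : List C → V → ℕ → List V → Set
  Ball F r d B = ∀ {x} → x ∈ B → Walk F x r d

  record Grown (E : List C) (Vs : List V) (r : V) (d size : ℕ) : Set where
    field
      ball   : List V
      size≡  : length ball ≡ size
      unique : Unique ball
      ball⊆  : ball ⊆ Vs
      isBall : Ball E r d ball

  module _ {Vs : List V} {r : V} {d : ℕ} where

    -- Absorb the edges of A, all touching the ball B, one by one: an edge with both
    -- ends already absorbed closes a cycle, any other one adds a vertex.
    addLayer : ∀ {B} A {E} B′ → Unique (A ++ E) → (∀ {i} → i ∈ A → Touches B i) → Within Vs A →
      Ball (A ++ E) r d B → B ⊆ B′ → Ball (A ++ E) r (suc d) B′ → Unique B′ → B′ ⊆ Vs →
      RainbowGirthAtMost λc (suc (suc d + suc d)) ⊎ Grown E Vs r (suc d) (length A + length B′)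
    addLayer [] B′ _ _ _ _ _ ball′ uB′ B′⊆Vs = inj₂ record
      { ball = B′ ; size≡ = refl ; unique = uB′ ; ball⊆ = B′⊆Vs ; isBall = ball′ }
    addLayer {B} (j ∷ A) {E} B′ u@(_ ∷ uA) touch inVs ball B⊆B′ ball′ uB′ B′⊆Vs =
      [ (λ s∈B → from (inj₁ (refl , refl)) s∈B (proj₂ (inVs (here refl))))
      , (λ t∈B → from (inj₂ (refl , refl)) t∈B (proj₁ (inVs (here refl)))) ]′ (touch (here refl))
      where
      from : ∀ {x y} → Joins j x y → x ∈ B → y ∈ Vs →
        RainbowGirthAtMost λc (suc (suc d + suc d)) ⊎ Grown E Vs r (suc d) (suc (length A + length B′))
      from {x} {y} jxy x∈B y∈Vs with y ∈? B′
      -- `y` may already belong to the new layer, at depth `suc d`; the walk from `x` has at most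
      -- `d` steps and is padded to the same bound.
      ... | yes y∈B′ = inj₁ (closeCycle (join (ball′ y∈B′) (walk-suc (ball x∈B))) jxy (here refl))
      ... | no  y∉B′ = subst (λ s → RainbowGirthAtMost λc (suc (suc d + suc d)) ⊎ Grown E Vs r (suc d) s) (+-suc (length A) (length B′))
        (addLayer A (y ∷ B′) uA (touch ∘ there) (inVs ∘ there)
          (walk-weaken there ∘ ball) (there ∘ B⊆B′)
          (λ { (here refl) → move (joins-sym jxy) (x∷xs-unique⇒x∉xs u) (walk-weaken there (ball x∈B))
             ; (there z∈)  → walk-weaken there (ball′ z∈) })
          (∷-unique y∉B′ uB′)
          (λ { (here refl) → y∈Vs ; (there z∈) → B′⊆Vs z∈ }))

  -- The field `cheap`, divided by `K`, says that at most (1 + 1/K)|piece| edges are lost.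
  record Carved (K : ℕ) (E : List C) (Vs : List V) : Set where
    field
      piece      : List V
      rest       : List C
      nonempty   : 1 ≤ length piece
      unique     : Unique piece
      piece⊆     : piece ⊆ Vs
      restUnique : Unique rest
      rest⊆      : rest ⊆ E
      avoids     : ∀ {i} → i ∈ rest → ¬ Touches piece i
      cheap      : K * length E ≤ K * length rest + suc K * length piece

  module _ (K R : ℕ) (radius : n * K ^ R < suc K ^ R) {E₀ : List C} {Vs : List V} (inVs : Within Vs E₀) where

    -- `E` is the list of edges not yet absorbed. Two invariants are carried: |B| ≥ (1 + 1/K)^d, and
    -- at most |B| edges have been absorbed, because each of them added a vertex.
    growBall : ∀ fuel d → fuel + d ≡ R → ∀ {r} E B → Unique E → E ⊆ E₀ → Ball E r d B →
      Unique B → B ⊆ Vs → 1 ≤ length B → suc K ^ d ≤ length B * K ^ d → length E₀ ≤ length E + length B →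
      RainbowGirthAtMost λc (suc (R + R)) ⊎ Carved K E₀ Vs
    -- At depth `R` the growth invariant would give the ball more than `n` vertices.
    growBall zero .R refl E B _ _ _ uB _ _ growth _ =
      contradiction (≤-trans growth (*-monoˡ-≤ (K ^ R) (unique-allFin-length uB))) (<⇒≱ radius)
    growBall (suc fuel) d fuel+d≡R {r} E B uE E⊆E₀ ball uB B⊆Vs 1≤B growth few =
      carveOrGrow (K * length A ≤? length B)
      where
      open ≤-Reasoning
      A E′ : List C
      A  = filter (touches? B) E
      E′ = filter (¬? ∘ touches? B) E
      uE′ : Unique E′
      uE′ = filter⁺ (¬? ∘ touches? B) uE
      E′⊆E : E′ ⊆ E
      E′⊆E = proj₁ ∘ ∈-filter⁻ (¬? ∘ touches? B)
      A+E′ : length A + length E′ ≡ length E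
      A+E′ = length-filter+filter-¬ (touches? B) E
      expand : ∀ k a e b → k * (a + e + b) ≡ k * a + (k * e + k * b)
      expand = solve-∀
      collect : ∀ k e b → b + (k * e + k * b) ≡ k * e + suc k * b
      collect = solve-∀
      disjoint : ∀ {i} → ¬ (i ∈ A × i ∈ E′)
      disjoint (i∈A , i∈E′) = proj₂ (∈-filter⁻ (¬? ∘ touches? B) {xs = E} i∈E′)
                                    (proj₂ (∈-filter⁻ (touches? B) {xs = E} i∈A))
      split : A ++ E′ ⊆ E
      split = [ proj₁ ∘ ∈-filter⁻ (touches? B) , E′⊆E ]′ ∘ ∈-++⁻ A
      1+d≤R : suc d ≤ R
      1+d≤R = ≤-trans (m≤n+m (suc d) fuel) (≤-reflexive (trans (+-suc fuel d) fuel+d≡R))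
      relax : RainbowGirthAtMost λc (suc (suc d + suc d)) → RainbowGirthAtMost λc (suc (R + R))
      relax (k , k< , cycle) = k , ≤-trans k< (s≤s (+-mono-≤ 1+d≤R 1+d≤R)) , cycle
      next-ball : ¬ K * length A ≤ length B → Grown E′ Vs r (suc d) (length A + length B) →
        RainbowGirthAtMost λc (suc (R + R)) ⊎ Carved K E₀ Vs
      next-ball continue grown = growBall fuel (suc d) (trans (+-suc fuel d) fuel+d≡R) E′ B″
        uE′ (E⊆E₀ ∘ E′⊆E)
        isBall unique ball⊆ (≤-trans 1≤B (≤-trans (m≤n+m _ (length A)) (≤-reflexive (sym size≡))))
        growth′ few′
        where
        open Grown grown renaming (ball to B″)
        a b : ℕ
        a = length A
        b = length B
        regroup : ∀ k a b p → (k * a + k * b) * p ≡ (a + b) * (k * p)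
        regroup = solve-∀
        -- Growth continues only if |A| > |B|/K, and each edge of `A` has added one vertex.
        growth′ : suc K ^ suc d ≤ length B″ * K ^ suc d
        growth′ = begin
          suc K * suc K ^ d         ≤⟨ *-monoʳ-≤ (suc K) growth ⟩
          suc K * (b * K ^ d)       ≡⟨ sym (*-assoc (suc K) b _) ⟩
          (b + K * b) * K ^ d       ≤⟨ *-monoˡ-≤ (K ^ d) (+-monoˡ-≤ (K * b) (<⇒≤ (≰⇒> continue))) ⟩
          (K * a + K * b) * K ^ d   ≡⟨ regroup K a b (K ^ d) ⟩
          (a + b) * (K * K ^ d)     ≡⟨ cong (_* K ^ suc d) (sym size≡) ⟩
          length B″ * K ^ suc d     ∎
        few′ : length E₀ ≤ length E′ + length B″
        few′ = begin
          length E₀                       ≤⟨ few ⟩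
          length E + b                    ≡⟨ cong (_+ b) (sym A+E′) ⟩
          a + length E′ + b               ≡⟨ cong (_+ b) (+-comm a (length E′)) ⟩
          length E′ + a + b               ≡⟨ +-assoc (length E′) a b ⟩
          length E′ + (a + b)             ≡⟨ cong (λ k → length E′ + k) (sym size≡) ⟩
          length E′ + length B″           ∎
      carveOrGrow : Dec (K * length A ≤ length B) → RainbowGirthAtMost λc (suc (R + R)) ⊎ Carved K E₀ Vs
      carveOrGrow (yes KA≤B) = inj₂ record
        { piece = B ; rest = E′ ; nonempty = 1≤B ; unique = uB ; piece⊆ = B⊆Vs
        ; restUnique = uE′
        ; rest⊆ = E⊆E₀ ∘ E′⊆E
        ; avoids = proj₂ ∘ ∈-filter⁻ (¬? ∘ touches? B) {xs = E}
        -- The lost edges are those absorbed, at most |B| by `few`, and those in `A`, at most |B|/K.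
        ; cheap = begin
            K * length E₀                                          ≤⟨ *-monoʳ-≤ K few ⟩
            K * (length E + length B)                              ≡⟨ cong (λ e → K * (e + length B)) (sym A+E′) ⟩
            K * (length A + length E′ + length B)                  ≡⟨ expand K (length A) (length E′) (length B) ⟩
            K * length A + (K * length E′ + K * length B)          ≤⟨ +-monoˡ-≤ _ KA≤B ⟩
            length B + (K * length E′ + K * length B)              ≡⟨ collect K (length E′) (length B) ⟩
            K * length E′ + suc K * length B                       ∎
        }
      carveOrGrow (no continue) = [ inj₁ ∘ relax , next-ball continue ]′
        (addLayer A {E′} B (++⁺ (filter⁺ (touches? B) uE) uE′ disjoint)
          (proj₂ ∘ ∈-filter⁻ (touches? B) {xs = E})
          (inVs ∘ E⊆E₀ ∘ proj₁ ∘ ∈-filter⁻ (touches? B))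
          (walk-weaken split ∘ ball) (λ x∈ → x∈)
          (walk-suc ∘ walk-weaken split ∘ ball) uB B⊆Vs)

  -- The density hypothesis is |E| > (1 + 1/K)|Vs|. Carving preserves it and removes vertices; since
  -- it fails for an empty edge list, a short cycle must appear before the edges run out.
  dense⇒rainbowGirth≤ : ∀ K R → n * K ^ R < suc K ^ R → ∀ E Vs → Unique E → Unique Vs →
    Within Vs E → suc K * length Vs < K * length E → RainbowGirthAtMost λc (suc (R + R))
  dense⇒rainbowGirth≤ K R radius E Vs = go (length Vs) E Vs ≤-refl
    where
    go : ∀ fuel E Vs → length Vs ≤ fuel → Unique E → Unique Vs → Within Vs E →
      suc K * length Vs < K * length E → RainbowGirthAtMost λc (suc (R + R))
    go _ [] Vs _ _ _ _ dense =
      contradiction (≤-trans dense (≤-reflexive (*-zeroʳ K))) λ ()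
    go zero (i ∷ E) [] _ _ _ inVs _ with () ← proj₁ (inVs (here refl))
    go (suc fuel) E@(i ∷ _) Vs Vs≤ uE uVs inVs dense = [ (λ short → short) , recurse ]′
      (growBall K R radius inVs R 0 (+-identityʳ R) {src i} E (src i ∷ []) uE (λ x → x)
        (λ { (here refl) → done }) ([] ∷ []) (λ { (here refl) → proj₁ (inVs (here refl)) })
        (s≤s z≤n) (s≤s z≤n) (m≤m+n _ 1))
      where
      open ≤-Reasoning
      recurse : Carved K E Vs → RainbowGirthAtMost λc (suc (R + R))
      recurse carved = go fuel rest Vs′ shrinks restUnique (filter⁺ (_∉? piece) uVs) inVs′ dense′
        where
        open Carved carved
        Vs′ : List V
        Vs′ = _∖_ Fin._≟_ Vs piece
        Vs′+piece : length Vs′ + length piece ≤ length Vs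
        Vs′+piece = length-∖-≤ Fin._≟_ uVs unique piece⊆
        shrinks : length Vs′ ≤ fuel
        shrinks = s≤s⁻¹ (begin
          suc (length Vs′)             ≡⟨ +-comm 1 _ ⟩
          length Vs′ + 1               ≤⟨ +-monoʳ-≤ (length Vs′) nonempty ⟩
          length Vs′ + length piece    ≤⟨ Vs′+piece ⟩
          length Vs                    ≤⟨ Vs≤ ⟩
          suc fuel                     ∎)
        inVs′ : Within Vs′ rest
        inVs′ i∈ with s , t ← inVs (rest⊆ i∈) =
          ∈-filter⁺ (_∉? piece) s (avoids i∈ ∘ inj₁) , ∈-filter⁺ (_∉? piece) t (avoids i∈ ∘ inj₂)
        dense′ : suc K * length Vs′ < K * length rest
        dense′ = +-cancelʳ-< (suc K * length piece) _ _ (begin-strict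
          suc K * length Vs′ + suc K * length piece   ≡⟨ sym (*-distribˡ-+ (suc K) (length Vs′) _) ⟩
          suc K * (length Vs′ + length piece)         ≤⟨ *-monoʳ-≤ (suc K) Vs′+piece ⟩
          suc K * length Vs                           <⟨ dense ⟩
          K * length E                                ≤⟨ cheap ⟩
          K * length rest + suc K * length piece      ∎)

-- Conditions under which a color class survives a deletion.

module _ {n m : ℕ} {G : Graph n} (λc : EdgeColoring G m) where

  open ListDec (Fin._≟_ {n}) using (_∈?_; _∉?_)

  -- A certificate for one class: a deleted set avoiding the centres and independent for the pairs
  -- leaves an edge. The bound 4 makes the total number of pairs linear in the number of colors.
  record Shield (i : Fin m) : Set where
    field
      centres : List (Fin n)
      pairs   : List (Fin n × Fin n)
      few     : length pairs ≤ 4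
      escape  : ∀ D → (∀ {c} → c ∈ centres → c ∉ D) → Independent pairs D →
                Σ (Fin n) λ u → Σ (Fin n) λ v → InClass λc i u v × u ∉ D × v ∉ D

  open Shield

  -- Once the centre `c` is kept, both edges are lost only if both leaves are deleted.
  starShield : ∀ {i c a b} → InClass λc i c a → InClass λc i c b → a ≢ b → Shield i
  starShield {i} {c} {a} {b} ca cb a≢b = record
    { centres = c ∷ [] ; pairs = (a , b) ∷ [] ; few = s≤s z≤n ; escape = esc }
    where
    esc : ∀ D → _ → _ → _
    esc D c∉D ind with a ∈? D | b ∈? D
    ... | no a∉D  | _       = c , a , ca , c∉D (here refl) , a∉D
    ... | _       | no b∉D  = c , b , cb , c∉D (here refl) , b∉D
    ... | yes a∈D | yes b∈D = contradiction (ind (here refl) a∈D b∈D) a≢b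

  -- Losing both edges takes a deleted end of each, so the four pairs across the matching suffice.
  matchingShield : ∀ {i} → ClassHasMatching2 λc i → Shield i
  matchingShield {i} (a , b , c , d , ab , cd , a≢c , a≢d , b≢c , b≢d) = record
    { centres = [] ; pairs = (a , c) ∷ (a , d) ∷ (b , c) ∷ (b , d) ∷ []
    ; few = ≤-refl ; escape = esc }
    where
    esc : ∀ D → _ → _ → _
    esc D _ ind with a ∈? D | b ∈? D | c ∈? D | d ∈? D
    ... | no a∉   | no b∉   | _       | _       = a , b , ab , a∉ , b∉
    ... | _       | _       | no c∉   | no d∉   = c , d , cd , c∉ , d∉
    ... | yes a∈  | _       | yes c∈  | _       = contradiction (ind (here refl) a∈ c∈) a≢c
    ... | yes a∈  | _       | _       | yes d∈  = contradiction (ind (there (here refl)) a∈ d∈) a≢d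
    ... | _       | yes b∈  | yes c∈  | _       = contradiction (ind (there (there (here refl))) b∈ c∈) b≢c
    ... | _       | yes b∈  | _       | yes d∈  = contradiction (ind (there (there (there (here refl)))) b∈ d∈) b≢d

  -- At most one corner can be deleted, and the opposite edge survives.
  triangleShield : ∀ {i} → ClassHasTriangle λc i → Shield i
  triangleShield {i} (a , b , c , ab , bc , ac) = record
    { centres = [] ; pairs = (a , b) ∷ (b , c) ∷ (a , c) ∷ []
    ; few = s≤s (s≤s (s≤s z≤n)) ; escape = esc }
    where
    esc : ∀ D → _ → _ → _
    esc D _ ind with a ∈? D | b ∈? D | c ∈? D
    ... | no a∉   | no b∉   | _       = a , b , ab , a∉ , b∉
    ... | no a∉   | _       | no c∉   = a , c , ac , a∉ , c∉
    ... | _       | no b∉   | no c∉   = b , c , bc , b∉ , c∉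
    ... | yes a∈  | yes b∈  | _       = contradiction (ind (here refl) a∈ b∈) (inClass⇒≢ λc ab)
    ... | _       | yes b∈  | yes c∈  = contradiction (ind (there (here refl)) b∈ c∈) (inClass⇒≢ λc bc)
    ... | yes a∈  | _       | yes c∈  = contradiction (ind (there (there (here refl))) a∈ c∈) (inClass⇒≢ λc ac)

  -- Two distinct edges either share an end, which becomes the only centre, or form a matching.
  shield₁ : ∀ {i} → ClassSizeAtLeastTwo λc i → Σ (Shield i) λ s → length (centres s) ≤ 1
  shield₁ (u , v , x , y , uv , xy , distinct)
    with u Fin.≟ x | u Fin.≟ y | v Fin.≟ x | v Fin.≟ y
  ... | yes refl | _ | _ | _ = starShield uv xy (λ v≡y → distinct (inj₁ (refl , v≡y))) , ≤-refl
  ... | _ | yes refl | _ | _ =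
    starShield uv (inClass-sym λc xy) (λ v≡x → distinct (inj₂ (refl , v≡x))) , ≤-refl
  ... | _ | _ | yes refl | _ =
    starShield (inClass-sym λc uv) xy (λ u≡y → distinct (inj₂ (u≡y , refl))) , ≤-refl
  ... | _ | _ | _ | yes refl =
    starShield (inClass-sym λc uv) (inClass-sym λc xy) (λ u≡x → distinct (inj₁ (u≡x , refl))) , ≤-refl
  ... | no u≢x | no u≢y | no v≢x | no v≢y =
    matchingShield (u , v , x , y , uv , xy , u≢x , u≢y , v≢x , v≢y) , z≤n

  shield₀ : ∀ {i} → ClassHasMatching2 λc i ⊎ ClassHasTriangle λc i → Σ (Shield i) λ s → length (centres s) ≤ 0
  shield₀ (inj₁ matching) = matchingShield matching , z≤n
  shield₀ (inj₂ triangle) = triangleShield triangle , z≤n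

-- A large deletable set and the resulting girth bound.

record DeletableSet {n} {G : Graph n} (λc : EdgeColoring G n) (K : ℕ) : Set where
  field
    set     : List (Fin n)
    unique  : Unique set
    large   : n ≤ K * length set
    survive : ∀ i → Σ (Fin n) λ u → Σ (Fin n) λ v → InClass λc i u v × u ∉ set × v ∉ set

length-allFin : ∀ n → length (allFin n) ≡ n
length-allFin n = length-tabulate {n = n} _

module _ {n : ℕ} {G : Graph n} (λc : EdgeColoring G n) where

  open Shield
  open ListDec (Fin._≟_ {n}) using (_∈?_; _∉?_)

  deletableSet : ∀ q → (∀ i → ClassSizeAtLeastTwo λc i) → ∀ S → Unique S →
    All (λ i → ClassHasMatching2 λc i ⊎ ClassHasTriangle λc i) S → n ≤ q * length S →
    DeletableSet λc (5 * q * suc (5 * q))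
  deletableSet q two S uS good n≤qS = record
    { set = D ; unique = uD ; large = large-D
    ; survive = λ i → escape (shield i) D
        (λ c∈ c∈D → proj₂ (∈-filter⁻ (_∉? Cs) {xs = allFin n} (D⊆Z c∈D)) (centre∈Cs i c∈))
        (λ ab∈ → ind (∈-concatMap⁺ (pairs ∘ shield) (lose (∈-allFin i) ab∈)))
    }
    where
    open ≤-Reasoning
    shieldFor : ∀ i → Dec (i ∈ S) →
      Σ (Shield λc i) λ s → length (centres s) ≤ 1 × (i ∈ S → length (centres s) ≤ 0)
    shieldFor i (yes i∈S) with s , none ← shield₀ λc (All.lookup good i∈S) =
      s , m≤n⇒m≤1+n none , λ _ → none
    shieldFor i (no i∉S) with s , one ← shield₁ λc (two i) =
      s , one , λ i∈S → contradiction i∈S i∉S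
    shield : ∀ i → Shield λc i
    shield i = proj₁ (shieldFor i (i ∈? S))
    bad Cs Z : List (Fin n)
    bad = _∖_ Fin._≟_ (allFin n) S
    Cs  = concatMap (centres ∘ shield) bad
    Z   = _∖_ Fin._≟_ (allFin n) Cs
    H : List (Fin n × Fin n)
    H   = concatMap (pairs ∘ shield) (allFin n)
    ¬∈-empty : ∀ {A : Set} {x : A} {xs} → length xs ≤ 0 → x ∉ xs
    ¬∈-empty {xs = []} _ ()
    centre∈Cs : ∀ i {c} → c ∈ centres (shield i) → c ∈ Cs
    centre∈Cs i c∈ = ∈-concatMap⁺ (centres ∘ shield) (lose (∈-filter⁺ (_∉? S) (∈-allFin i)
      λ i∈S → ¬∈-empty (proj₂ (proj₂ (shieldFor i (i ∈? S))) i∈S) c∈) c∈)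
    uZ : Unique Z
    uZ = filter⁺ (_∉? Cs) (allFin⁺ n)
    -- Only classes outside `S` have a centre, at most one each. As there are `n` colors and `n`
    -- vertices, at least |S| vertices are not centres.
    S≤Z : length S ≤ length Z
    S≤Z = +-cancelˡ-≤ (length bad) _ _ (begin
      length bad + length S   ≤⟨ length-∖-≤ Fin._≟_ (allFin⁺ n) uS (λ _ → ∈-allFin _) ⟩
      length (allFin n)       ≤⟨ length-∖-≥ Fin._≟_ Cs (allFin⁺ n) ⟩
      length Z + length Cs    ≤⟨ +-monoʳ-≤ (length Z) (length-concatMap-≤ _ 1 (λ i → proj₁ (proj₂ (shieldFor i (i ∈? S)))) bad) ⟩
      length Z + length bad * 1 ≡⟨ cong (λ b → length Z + b) (*-identityʳ _) ⟩
      length Z + length bad   ≡⟨ +-comm (length Z) _ ⟩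
      length bad + length Z   ∎)
    -- With t = 5q the quantity t|Z| is at least 5n; the pairs use up at most 4n, and the remaining
    -- `n` bounds the size of `D` from below.
    t : ℕ
    t = 5 * q
    open IndependentIn (independentIn Fin._≟_ t H uZ)
      renaming (set to D; set⊆Z to D⊆Z; unique to uD; independent to ind)
    H≤4n : length H ≤ 4 * n
    H≤4n = begin
      length H                ≤⟨ length-concatMap-≤ _ 4 (few ∘ shield) (allFin n) ⟩
      length (allFin n) * 4   ≡⟨ cong (_* 4) (length-allFin n) ⟩
      n * 4                   ≡⟨ *-comm n 4 ⟩
      4 * n                   ∎
    large-D : n ≤ t * suc t * length D
    large-D = +-cancelˡ-≤ (4 * n) _ _ (begin
      4 * n + n                         ≡⟨ +-comm (4 * n) n ⟩
      5 * n                             ≤⟨ *-monoʳ-≤ 5 n≤qS ⟩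
      5 * (q * length S)                ≡⟨ sym (*-assoc 5 q _) ⟩
      t * length S                      ≤⟨ *-monoʳ-≤ t S≤Z ⟩
      t * length Z                      ≤⟨ large ⟩
      length H + t * suc t * length D   ≤⟨ +-monoˡ-≤ _ H≤4n ⟩
      4 * n + t * suc t * length D      ∎)

  deletable⇒rainbowGirth≤ : ∀ K .{{_ : NonZero K}} → 2 ≤ n → DeletableSet λc K →
    RainbowGirthAtMost λc (suc (4 * K) * ⌈log₂ n ⌉)
  deletable⇒rainbowGirth≤ K 2≤n deletable = enlarge
    (dense⇒rainbowGirth≤ K R radius (allFin n) Vs (allFin⁺ n) (filter⁺ (_∉? D) (allFin⁺ n))
      (λ {i} _ → ∈-filter⁺ (_∉? D) (∈-allFin _) (proj₁ (proj₂ (proj₂ (proj₂ (survive i)))))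
               , ∈-filter⁺ (_∉? D) (∈-allFin _) (proj₂ (proj₂ (proj₂ (proj₂ (survive i))))))
      dense)
    where
    open ≤-Reasoning
    open DeletableSet deletable renaming (set to D; unique to uD)
    open Transversal λc (λ i → proj₁ (survive i)) (λ i → proj₁ (proj₂ (survive i)))
      (λ i → proj₁ (proj₂ (proj₂ (survive i))))
    L R : ℕ
    L = ⌈log₂ n ⌉
    -- `K * L` steps already give growth 2^L ≥ n; the extra `K` steps make the inequality strict.
    R = K * suc L
    Vs : List (Fin n)
    Vs = _∖_ Fin._≟_ (allFin n) D
    Vs+D≤n : length Vs + length D ≤ n
    Vs+D≤n = ≤-trans (length-∖-≤ Fin._≟_ (allFin⁺ n) uD (λ _ → ∈-allFin _)) (≤-reflexive (length-allFin n))
    0<D : 0 < length D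
    0<D with length D | large
    ... | zero  | n≤0 = contradiction (≤-trans 2≤n (≤-trans n≤0 (≤-reflexive (*-zeroʳ K)))) λ ()
    ... | suc _ | _   = s≤s z≤n
    -- All `n` colors keep an edge on at most n - |D| vertices. The claim reduces to n < (K + 1)|D|,
    -- which follows from n ≤ K|D| and |D| > 0.
    dense : suc K * length Vs < K * length (allFin n)
    dense = +-cancelʳ-< (suc K * length D) _ _ (begin-strict
      suc K * length Vs + suc K * length D    ≡⟨ sym (*-distribˡ-+ (suc K) (length Vs) _) ⟩
      suc K * (length Vs + length D)          ≤⟨ *-monoʳ-≤ (suc K) Vs+D≤n ⟩
      n + K * n                               ≤⟨ +-monoˡ-≤ (K * n) large ⟩
      K * length D + K * n                    <⟨ +-monoˡ-< (K * n) (+-monoˡ-≤ (K * length D) 0<D) ⟩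
      suc K * length D + K * n                ≡⟨ +-comm (suc K * length D) _ ⟩
      K * n + suc K * length D                ≡⟨ cong (λ l → K * l + suc K * length D) (sym (length-allFin n)) ⟩
      K * length (allFin n) + suc K * length D ∎)
    radius : n * K ^ R < suc K ^ R
    radius = begin-strict
      n * K ^ R             ≤⟨ *-monoˡ-≤ (K ^ R) (n≤2^⌈log₂n⌉ n) ⟩
      2 ^ L * K ^ R         <⟨ *-monoˡ-< (K ^ R) {{m^n≢0 K R}} (^-monoʳ-< 2 ≤-refl (n<1+n L)) ⟩
      2 ^ suc L * K ^ R     ≤⟨ 2^l*k^kl≤[1+k]^kl K (suc L) ⟩
      suc K ^ R             ∎
    -- For m ≥ 2 the logarithm is at least 1 and absorbs the additive terms; matching on `m` exposes
    -- it as a successor.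
    length-bound : ∀ m → 2 ≤ m → suc (K * suc ⌈log₂ m ⌉ + K * suc ⌈log₂ m ⌉) ≤ suc (4 * K) * ⌈log₂ m ⌉
    length-bound 1 (s≤s ())
    length-bound m@(suc (suc _)) _ = ≤-trans (m≤m+n _ _) (≤-reflexive (excess K _))
      where
      excess : ∀ k l → suc (k * suc (suc l) + k * suc (suc l)) + (2 * k * l + l) ≡ suc (4 * k) * suc l
      excess = solve-∀
    enlarge : RainbowGirthAtMost λc (suc (R + R)) → RainbowGirthAtMost λc (suc (4 * K) * L)
    enlarge (k , k< , cycle) = k , ≤-trans k< (length-bound n 2≤n) , cycle

-- From a rational density to natural constants.

-- A positive rational has numerator at least 1, so it is at least the reciprocal of its
-- denominator.
α*n≤s⇒n≤q*s : ∀ α → Positive α → ∀ n s → α *ℚ ((+ n) / 1) ≤ℚ ((+ s) / 1) → n ≤ ℚ.denominatorℕ α * s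
α*n≤s⇒n≤q*s α@(mkℚ (+ suc p) d _) _ n s h = begin
  n                      ≤⟨ m≤m+n n (p * n) ⟩
  suc p * n              ≡⟨ sym (*-identityʳ _) ⟩
  suc p * n * 1          ≤⟨ ℤ.drop‿+≤+ cross ⟩
  s * (suc d * 1)        ≡⟨ cong (s *_) (*-identityʳ (suc d)) ⟩
  s * suc d              ≡⟨ *-comm s (suc d) ⟩
  suc d * s              ∎
  where
  open ≤-Reasoning
  integer : ∀ k → toℚᵘ (+ k / 1) ℚᵘ.≃ ℚᵘ.mkℚᵘ (+ k) 0
  integer k = ℚ.toℚᵘ-fromℚᵘ (ℚᵘ.mkℚᵘ (+ k) 0)
  unnormalised : toℚᵘ α ℚᵘ.* ℚᵘ.mkℚᵘ (+ n) 0 ℚᵘ.≤ ℚᵘ.mkℚᵘ (+ s) 0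
  unnormalised = ℚᵘ.≤-respˡ-≃ (ℚᵘ.≃-trans (ℚ.toℚᵘ-homo-* α (+ n / 1)) (ℚᵘ.*-congˡ {toℚᵘ α} (integer n)))
    (ℚᵘ.≤-respʳ-≃ (integer s) (ℚ.toℚᵘ-mono-≤ h))
  cross : + (suc p * n * 1) ℤ.≤ + (s * (suc d * 1))
  cross = subst₂ ℤ._≤_ (trans (cong (ℤ._* + 1) (sym (ℤ.pos-* (suc p) n))) (sym (ℤ.pos-* (suc p * n) 1)))
    (sym (ℤ.pos-* s (suc d * 1))) (ℚᵘ.drop-*≤* unnormalised)

theorem1p11 : (α : ℚ) → Positive α →
    Σ ℕ λ C → 0 < C ×
    ((n : ℕ) → .{{_ : NonZero n}} → (G : Graph n) → (λc : EdgeColoring G n) →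
    ((i : Fin n) → ClassSizeAtLeastTwo λc i) →
    (Σ (List (Fin n)) λ S → Unique S ×
    All (λ i → ClassHasMatching2 λc i ⊎ ClassHasTriangle λc i) S ×
    α *ℚ ((+ n) / 1) ≤ℚ ((+ length S) / 1)) →
    RainbowGirthAtMost λc (C * ⌈log₂ n ⌉))
theorem1p11 α@record{} α>0 = suc (4 * K) , s≤s z≤n , λ n G λc two (S , uS , good , dense) →
  deletable⇒rainbowGirth≤ λc K (order≥2 n λc two)
    (deletableSet λc q two S uS good (α*n≤s⇒n≤q*s α α>0 n (length S) dense))
  where
  q K : ℕ
  q = ℚ.denominatorℕ α
  K = 5 * q * suc (5 * q)
  -- A single vertex would make the logarithm 0. It is excluded because its one color class would
  -- have to contain a loop.
  order≥2 : ∀ n .{{_ : NonZero n}} {G : Graph n} (λc : EdgeColoring G n) →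
    (∀ i → ClassSizeAtLeastTwo λc i) → 2 ≤ n
  order≥2 zero _ _ = contradiction refl (≢-nonZero⁻¹ 0)
  order≥2 1 λc two with zero , zero , _ , _ , (adj , col≡) , _ ← two zero =
    contradiction refl (inClass⇒≢ λc (adj , col≡))
  order≥2 (suc (suc _)) _ _ = s≤s (s≤s z≤n)
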